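{- Let $n \geq 1$, and let $R \subseteq \mathcal{F}^n$ be a cardinality relation which is not definable in $(\mathbb{N},<)$. The functions $+$ and $\times$ on $\mathbb{N}$ are definable in $(\mathbb{N},<,R)$. Thus $\mathrm{WMSO}(\mathbb{N},<,R)$ is undecidable.
   Context: $\mathcal{F}$ denotes the set of finite subsets of $\mathbb{N}$ and $|X|$ the cardinality of $X\in\mathcal{F}$. Definable means definable in weak monadic second-order logic (WMSO): first-order variables range over $\mathbb{N}$, monadic second-order variables range over finite subsets of $\mathbb{N}$, and atomic formulas use membership $x\in X$ and the symbols of the signature (a symbol for a relation $R\subseteq\mathcal{F}^n$ takes $n$ monadic second-order arguments). A relation $S\subseteq\mathbb{N}^m\times\mathcal{F}^k$ is definable in a structure with domain $\mathbb{N}$ if there is a WMSO formula $\varphi(x_1,\dots,x_m,X_1,\dots,X_k)$ over its signature that holds exactly for the tuples of $S$. A function on $\mathbb{N}$ is definable if its graph is; so $+$ is definable if $\{(x,y,z)\in\mathbb{N}^3 : x+y=z\}$ is definable, and similarly for $\times$. $\mathrm{WMSO}(\mathcal{M})$ denotes the weak monadic second-order theory of $\mathcal{M}$, i.e. the set of WMSO sentences true in $\mathcal{M}$. A relation $R\subseteq \mathcal{F}^n$ ($n\ge 1$) is a cardinality relation if for all $X_1,\dots,X_n,Y_1,\dots,Y_n\in\mathcal{F}$ with $|X_i|=|Y_i|$ for every $i\in\{1,\dots,n\}$, we have $(X_1,\dots,X_n)\in R$ iff $(Y_1,\dots,Y_n)\in R$. -}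

module Defs where

open import Data.Fin.Base using (Fin; toℕ)
open import Data.List.Base using (List; length)
import Data.List.Membership.Propositional as Membership
open import Data.List.Relation.Unary.All as All using (All)
open import Data.List.Relation.Unary.AllPairs using (AllPairs)
open import Data.List.Relation.Unary.Any using (index)
open import Data.Nat.Base using (ℕ; zero; suc; _+_; _<_)
open import Data.Product.Base using (∃; _×_)
open import Data.Sum.Base using (_⊎_)
open import Data.Vec.Base using (Vec; []; _∷_; lookup; map)
open import Function.Bundles using (_⇔_)
open import Level using (0ℓ)
open import Relation.Binary.PropositionalEquality.Core using (_≡_)
open import Relation.Nullary.Negation.Core using (¬_)
open import Relation.Unary using (Pred)

open Membership using () renaming (_∈_ to _∈ˡ_)

-- A finite subset of ℕ is represented by its strictly increasing
-- enumeration, so that equal sets are propositionally equal.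

record FiniteSet : Set where
  constructor mkFiniteSet
  field
    elements   : List ℕ
    increasing : AllPairs _<_ elements

open FiniteSet public

infix 4 _∈_

_∈_ : ℕ → FiniteSet → Set
x ∈ X = x ∈ˡ elements X

∣_∣ : FiniteSet → ℕ
∣ X ∣ = length (elements X)

SetRelation : ℕ → Set₁
SetRelation n = Pred (Vec FiniteSet n) 0ℓ

IsCardinalityRelation : ∀ {n} → SetRelation n → Set
IsCardinalityRelation {n} R =
  (Xs Ys : Vec FiniteSet n) →
  (∀ i → ∣ lookup Xs i ∣ ≡ ∣ lookup Ys i ∣) →
  R Xs ⇔ R Ys

-- A signature lists the arities of the relation symbols on finite sets
-- that are added to the binary symbol < on ℕ, which is always present.
-- A relation symbol of arity n is a position of n in this list.

Signature : Set
Signature = List ℕ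

Structure : Signature → Set₁
Structure σ = All SetRelation σ

-- Formula σ m k: m free first-order and k free second-order variables,
-- as de Bruijn indices (each quantifier binds index zero of its sort).
-- The superscripts ¹ and ² indicate the sort of a quantified variable.

data Formula (σ : Signature) : ℕ → ℕ → Set where
  less    : ∀ {m k} → Fin m → Fin m → Formula σ m k
  mem     : ∀ {m k} → Fin m → Fin k → Formula σ m k
  rel     : ∀ {m k n} → n ∈ˡ σ → Vec (Fin k) n → Formula σ m k
  not     : ∀ {m k} → Formula σ m k → Formula σ m k
  _and_   : ∀ {m k} → Formula σ m k → Formula σ m k → Formula σ m k
  _or_    : ∀ {m k} → Formula σ m k → Formula σ m k → Formula σ m k
  _imp_   : ∀ {m k} → Formula σ m k → Formula σ m k → Formula σ m k
  exists¹ : ∀ {m k} → Formula σ (suc m) k → Formula σ m k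
  forall¹ : ∀ {m k} → Formula σ (suc m) k → Formula σ m k
  exists² : ∀ {m k} → Formula σ m (suc k) → Formula σ m k
  forall² : ∀ {m k} → Formula σ m (suc k) → Formula σ m k

infix 4 _⊨_[_,_]

_⊨_[_,_] : ∀ {σ m k} → Structure σ → Formula σ m k →
           Vec ℕ m → Vec FiniteSet k → Set
M ⊨ less i j  [ xs , Xs ] = lookup xs i < lookup xs j
M ⊨ mem i j   [ xs , Xs ] = lookup xs i ∈ lookup Xs j
M ⊨ rel r js  [ xs , Xs ] = All.lookup M r (map (lookup Xs) js)
M ⊨ not φ     [ xs , Xs ] = ¬ (M ⊨ φ [ xs , Xs ])
M ⊨ φ and ψ   [ xs , Xs ] = (M ⊨ φ [ xs , Xs ]) × (M ⊨ ψ [ xs , Xs ])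
M ⊨ φ or ψ    [ xs , Xs ] = (M ⊨ φ [ xs , Xs ]) ⊎ (M ⊨ ψ [ xs , Xs ])
M ⊨ φ imp ψ   [ xs , Xs ] = M ⊨ φ [ xs , Xs ] → M ⊨ ψ [ xs , Xs ]
M ⊨ exists¹ φ [ xs , Xs ] = ∃ λ x → M ⊨ φ [ x ∷ xs , Xs ]
M ⊨ forall¹ φ [ xs , Xs ] = ∀ x → M ⊨ φ [ x ∷ xs , Xs ]
M ⊨ exists² φ [ xs , Xs ] = ∃ λ X → M ⊨ φ [ xs , X ∷ Xs ]
M ⊨ forall² φ [ xs , Xs ] = ∀ X → M ⊨ φ [ xs , X ∷ Xs ]

Definable : ∀ {σ m k} → Structure σ →
            (Vec ℕ m → Vec FiniteSet k → Set) → Set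
Definable {σ} {m} {k} M S =
  ∃ λ (φ : Formula σ m k) → ∀ xs Xs → (M ⊨ φ [ xs , Xs ]) ⇔ S xs Xs

DefinableSetRelation : ∀ {σ n} → Structure σ → SetRelation n → Set
DefinableSetRelation M R = Definable {m = 0} M (λ _ Xs → R Xs)

Graph : (ℕ → ℕ → ℕ) → Vec ℕ 3 → Vec FiniteSet 0 → Set
Graph f (x ∷ y ∷ z ∷ []) _ = f x y ≡ z

DefinableFunction : ∀ {σ} → Structure σ → (ℕ → ℕ → ℕ) → Set
DefinableFunction M f = Definable M (Graph f)

Sentence : Signature → Set
Sentence σ = Formula σ 0 0

WMSO : ∀ {σ} → Structure σ → Pred (Sentence σ) 0ℓ
WMSO M φ = M ⊨ φ [ [] , [] ]

-- Decidability of a theory is taken in the sense of computability, with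
-- μ-recursive functions as the model. Agda's Dec would not do: it is
-- trivially inhabited in the presence of excluded middle.

data Rec : ℕ → Set where
  zero : ∀ {n} → Rec n
  succ : Rec 1
  proj : ∀ {n} → Fin n → Rec n
  comp : ∀ {n k} → Rec k → Vec (Rec n) k → Rec n
  prec : ∀ {n} → Rec n → Rec (2 + n) → Rec (suc n)
  min  : ∀ {n} → Rec (suc n) → Rec n

infix 4 _[_]⇓_

-- f [ xs ]⇓ y : the partial function f is defined at xs with value y.

data _[_]⇓_ : ∀ {n} → Rec n → Vec ℕ n → ℕ → Set where
  zero⇓ : ∀ {n} {xs : Vec ℕ n} → zero [ xs ]⇓ 0
  succ⇓ : ∀ {x} → succ [ x ∷ [] ]⇓ suc x
  proj⇓ : ∀ {n} {xs : Vec ℕ n} i → proj i [ xs ]⇓ lookup xs i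
  comp⇓ : ∀ {n k} {f : Rec k} {gs : Vec (Rec n) k} {xs} {z} (ys : Vec ℕ k) →
          (∀ i → lookup gs i [ xs ]⇓ lookup ys i) →
          f [ ys ]⇓ z →
          comp f gs [ xs ]⇓ z
  prec⇓-zero : ∀ {n} {f : Rec n} {g xs y} →
               f [ xs ]⇓ y →
               prec f g [ 0 ∷ xs ]⇓ y
  prec⇓-suc  : ∀ {n} {f : Rec n} {g xs x y z} →
               prec f g [ x ∷ xs ]⇓ y →
               g [ x ∷ y ∷ xs ]⇓ z →
               prec f g [ suc x ∷ xs ]⇓ z
  min⇓  : ∀ {n} {f : Rec (suc n)} {xs y} →
          f [ y ∷ xs ]⇓ 0 →
          (∀ x → x < y → ∃ λ v → f [ x ∷ xs ]⇓ suc v) →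
          min f [ xs ]⇓ y

-- Gödel numbering, by means of the Cantor pairing function.

triangle : ℕ → ℕ
triangle zero    = 0
triangle (suc n) = suc n + triangle n

pair : ℕ → ℕ → ℕ
pair x y = triangle (x + y) + y

codeVars : ∀ {k n} → Vec (Fin k) n → ℕ
codeVars []       = 0
codeVars (i ∷ is) = suc (pair (toℕ i) (codeVars is))

⌜_⌝ : ∀ {σ m k} → Formula σ m k → ℕ
⌜ less i j ⌝  = pair 0 (pair (toℕ i) (toℕ j))
⌜ mem i j ⌝   = pair 1 (pair (toℕ i) (toℕ j))
⌜ rel r js ⌝  = pair 2 (pair (toℕ (index r)) (codeVars js))
⌜ not φ ⌝     = pair 3 ⌜ φ ⌝
⌜ φ and ψ ⌝   = pair 4 (pair ⌜ φ ⌝ ⌜ ψ ⌝)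
⌜ φ or ψ ⌝    = pair 5 (pair ⌜ φ ⌝ ⌜ ψ ⌝)
⌜ φ imp ψ ⌝   = pair 6 (pair ⌜ φ ⌝ ⌜ ψ ⌝)
⌜ exists¹ φ ⌝ = pair 7 ⌜ φ ⌝
⌜ forall¹ φ ⌝ = pair 8 ⌜ φ ⌝
⌜ exists² φ ⌝ = pair 9 ⌜ φ ⌝
⌜ forall² φ ⌝ = pair 10 ⌜ φ ⌝

-- A set of sentences is decidable if some μ-recursive function, given
-- the code of any sentence, halts with 1 or 0 according to whether the
-- sentence is in the set.

DecidableTheory : ∀ {σ} → Pred (Sentence σ) 0ℓ → Set
DecidableTheory {σ} T =
  ∃ λ (f : Rec 1) → (φ : Sentence σ) →
    (T φ → f [ ⌜ φ ⌝ ∷ [] ]⇓ 1) × (¬ T φ → f [ ⌜ φ ⌝ ∷ [] ]⇓ 0)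

UndecidableTheory : ∀ {σ} → Pred (Sentence σ) 0ℓ → Set
UndecidableTheory T = ¬ DecidableTheory T

⟨ℕ,<⟩ : Structure List.[]
⟨ℕ,<⟩ = All.[]

⟨ℕ,<,_⟩ : ∀ {n} → SetRelation n → Structure (n List.∷ List.[])
⟨ℕ,<, R ⟩ = R All.∷ All.[]

{-# OPTIONS --safe #-}

-- Call a and b congruent if R cannot tell a + x from b + x in its first
-- argument, for any x and any other arguments. This is a congruence of (ℕ,+).
-- If it is equality, then |X| = |Y| is definable: R cannot tell X ∪ Z from
-- Y ∪ Z, for all Z beyond X and Y. Otherwise R is a finite union of products
-- of ultimately periodic conditions on the first argument with slices of R,
-- and by induction on the arity either |X| = |Y| is definable or R is definable
-- in (ℕ,<).
--
-- From |X| = |Y| one gets x + y = z, comparing [x,z) with [0,y), and x * y = z,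
-- counting the multiples of x below z. With the pairing function, finite sets
-- code the histories of recursions, so the graphs of μ-recursive functions are
-- definable. Were one of them to decide the theory, truth would be definable
-- and a sentence could assert its own falsity.

module Submission where

open import Defs
open import Axiom.ExcludedMiddle using (ExcludedMiddle)
open import Data.Empty using (⊥; ⊥-elim)
open import Data.Fin.Base using (Fin; zero; suc; toℕ; _↑ˡ_; _↑ʳ_)
open import Data.Fin.Patterns
open import Data.List.Base using (List; []; _∷_; filter; length; upTo; applyUpTo; _++_)
open import Data.List.Extrema.Nat using (max; xs≤max)
open import Data.List.Membership.Propositional using () renaming (_∈_ to _∈ˡ_)
open import Data.List.Membership.Propositional.Properties
  using (∈-filter⁺; ∈-filter⁻; ∈-upTo⁺; ∈-applyUpTo⁺; ∈-applyUpTo⁻; ∈-++⁺ˡ; ∈-++⁺ʳ; ∈-++⁻)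
open import Data.List.Properties
  using (length-applyUpTo; length-++; filter-all; filter-none; filter-accept; filter-reject)
open import Data.List.Relation.Unary.All as All using (All; []; _∷_)
open import Data.List.Relation.Unary.AllPairs using (AllPairs; []; _∷_)
import Data.List.Relation.Unary.AllPairs.Properties as AllPairs
open import Data.List.Relation.Unary.Any using (here; there)
open import Data.Nat.Base
  using (ℕ; zero; suc; _+_; _*_; _∸_; _⊔_; _≤_; _<_; _≥_; z≤n; s≤s; NonZero)
open import Data.Nat.DivMod using (_/_; _%_; m≡m%n+[m/n]*n; m%n<n)
open import Data.Nat.Induction using (<-wellFounded)
open import Data.Nat.Properties
open import Data.List.Membership.DecPropositional _≟_ using (_∈?_)
open import Data.Nat.Solver using (module +-*-Solver)
open import Data.Product.Base using (∃; _×_; _,_; proj₁; proj₂)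
open import Data.Sum.Base using (_⊎_; inj₁; inj₂; [_,_]′)
open import Data.Unit.Base using (⊤; tt)
open import Data.Vec.Base as Vec using (Vec; []; _∷_; lookup; map; allFin)
open import Data.Vec.Properties
  using (map-∘; map-cong; lookup-map; lookup-++ˡ; lookup-++ʳ; map-lookup-allFin)
open import Data.Vec.Relation.Binary.Pointwise.Extensional using (ext; Pointwise-≡⇒≡)
open import Function.Base using (_∘_; id)
open import Function.Bundles using (_⇔_; mk⇔; Equivalence)
open import Function.Construct.Composition using () renaming (_⇔-∘_ to infixl 8 _⇔-∘_)
open import Function.Construct.Identity using (⇔-id)
open import Function.Construct.Symmetry using (⇔-sym)
open import Induction.WellFounded using (WellFounded; Acc; acc; module Subrelation)
open import Level using (0ℓ)
open import Relation.Binary.Definitions using (tri<; tri≈; tri>)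
open import Relation.Binary.PropositionalEquality
  using (_≡_; refl; sym; trans; cong; cong₂; subst)
open import Relation.Nullary.Decidable.Core using (yes; no)
open import Relation.Nullary.Negation.Core using (¬_)

open Equivalence using (to; from)

subst⇔ : ∀ {A : Set} (P : A → Set) {x y} → x ≡ y → P x ⇔ P y
subst⇔ P eq = mk⇔ (subst P eq) (subst P (sym eq))

-- Finite sets

-- Each head is the least element of its list, so the heads agree. They do not recur in the tails,
-- hence the tails again have the same elements.
increasing-ext : ∀ {xs ys} → AllPairs _<_ xs → AllPairs _<_ ys →
                 (∀ u → u ∈ˡ xs ⇔ u ∈ˡ ys) → xs ≡ ys
increasing-ext [] [] _ = refl
increasing-ext [] (_ ∷ _) same with () ← from (same _) (here refl)
increasing-ext (_ ∷ _) [] same with () ← to (same _) (here refl)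
increasing-ext {x ∷ xs} {y ∷ ys} (x< ∷ xs↗) (y< ∷ ys↗) same =
  cong₂ _∷_ x≡y (increasing-ext xs↗ ys↗ λ u → mk⇔ (to′ u) (from′ u))
  where
  least : ∀ {a b as bs} → All (b <_) bs → AllPairs _<_ (a ∷ as) →
          a ∈ˡ b ∷ bs → b ∈ˡ a ∷ as → a ≡ b
  least _ _ (here a≡b) _ = a≡b
  least _ _ (there _) (here b≡a) = sym b≡a
  least b< (a< ∷ _) (there a∈) (there b∈) =
    ⊥-elim (<-asym (All.lookup b< a∈) (All.lookup a< b∈))

  x≡y : x ≡ y
  x≡y = least y< (x< ∷ xs↗) (to (same x) (here refl)) (from (same y) (here refl))

  to′ : ∀ u → u ∈ˡ xs → u ∈ˡ ys
  to′ u u∈ with to (same u) (there u∈)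
  ... | here refl = ⊥-elim (<-irrefl x≡y (All.lookup x< u∈))
  ... | there u∈′ = u∈′

  from′ : ∀ u → u ∈ˡ ys → u ∈ˡ xs
  from′ u u∈ with from (same u) (there u∈)
  ... | here refl = ⊥-elim (<-irrefl (sym x≡y) (All.lookup y< u∈))
  ... | there u∈′ = u∈′

∣∣-ext : ∀ X Y → (∀ u → u ∈ X ⇔ u ∈ Y) → ∣ X ∣ ≡ ∣ Y ∣
∣∣-ext X Y same = cong length (increasing-ext (increasing X) (increasing Y) same)

-- Filtering an initial segment of ℕ that reaches past the maximum sorts the list and removes
-- repetitions at once.
fromList : List ℕ → FiniteSet
fromList xs = mkFiniteSet
  (filter (_∈? xs) (upTo (suc (max 0 xs))))
  (AllPairs.filter⁺ (_∈? xs) (AllPairs.applyUpTo⁺₁ id _ λ i<j _ → i<j))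

∈-fromList : ∀ xs u → u ∈ fromList xs ⇔ u ∈ˡ xs
∈-fromList xs u = mk⇔
  (proj₂ ∘ ∈-filter⁻ (_∈? xs) {xs = upTo (suc (max 0 xs))})
  (λ u∈ → ∈-filter⁺ (_∈? xs) (∈-upTo⁺ (s≤s (All.lookup (xs≤max 0 xs) u∈))) u∈)

interval : ℕ → ℕ → FiniteSet
interval x c = mkFiniteSet (applyUpTo (x +_) c)
  (AllPairs.applyUpTo⁺₁ (x +_) c λ i<j _ → +-monoʳ-< x i<j)

∣interval∣ : ∀ x c → ∣ interval x c ∣ ≡ c
∣interval∣ x = length-applyUpTo (x +_)

∈-interval : ∀ x c u → u ∈ interval x c ⇔ (x ≤ u × u < x + c)
∈-interval x c u = mk⇔
  (λ u∈ → let i , i<c , u≡ = ∈-applyUpTo⁻ (x +_) u∈ in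
    subst (x ≤_) (sym u≡) (m≤m+n x i) ,
    subst (_< x + c) (sym u≡) (+-monoʳ-< x i<c))
  (λ (x≤u , u<x+c) →
    subst (_∈ interval x c) (m+[n∸m]≡n x≤u)
      (∈-applyUpTo⁺ (x +_) (+-cancelˡ-< x _ _
        (subst (_< x + c) (sym (m+[n∸m]≡n x≤u)) u<x+c))))

segment : ℕ → FiniteSet
segment = interval 0

∈-segment : ∀ c u → u ∈ segment c ⇔ u < c
∈-segment c u = mk⇔ (proj₂ ∘ to (∈-interval 0 c u)) (λ u<c → from (∈-interval 0 c u) (z≤n , u<c))

upperBound : FiniteSet → ℕ
upperBound X = suc (max 0 (elements X))

<upperBound : ∀ X {u} → u ∈ X → u < upperBound X
<upperBound X u∈ = s≤s (All.lookup (xs≤max 0 (elements X)) u∈)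

infix 4 _≪_

_≪_ : FiniteSet → FiniteSet → Set
X ≪ Z = ∀ u → u ∈ X → ∀ v → v ∈ Z → u < v

IsUnion : FiniteSet → FiniteSet → FiniteSet → Set
IsUnion X Z U = ∀ u → u ∈ U ⇔ (u ∈ X ⊎ u ∈ Z)

append : ∀ X Z → X ≪ Z → FiniteSet
append X Z X≪Z = mkFiniteSet (elements X ++ elements Z)
  (AllPairs.++⁺ (increasing X) (increasing Z)
    (All.tabulate λ u∈ → All.tabulate λ v∈ → X≪Z _ u∈ _ v∈))

append-isUnion : ∀ X Z (X≪Z : X ≪ Z) → IsUnion X Z (append X Z X≪Z)
append-isUnion X Z X≪Z u = mk⇔ (∈-++⁻ (elements X)) [ ∈-++⁺ˡ , ∈-++⁺ʳ (elements X) ]′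

∣union∣ : ∀ {X Z U} → X ≪ Z → IsUnion X Z U → ∣ U ∣ ≡ ∣ X ∣ + ∣ Z ∣
∣union∣ {X} {Z} {U} X≪Z U=X∪Z = trans
  (∣∣-ext U (append X Z X≪Z) λ u → mk⇔
    (λ u∈ → from (append-isUnion X Z X≪Z u) (to (U=X∪Z u) u∈))
    (λ u∈ → from (U=X∪Z u) (to (append-isUnion X Z X≪Z u) u∈)))
  (length-++ (elements X))

-- Counting the elements of a finite set from the top

GreatestBelow : FiniteSet → ℕ → ℕ → Set
GreatestBelow X t y = y ∈ X × y < t × (∀ u → u ∈ X → ¬ (y < u × u < t))

NoneBelow : FiniteSet → ℕ → Set
NoneBelow X t = ∀ u → u ∈ X → ¬ u < t

countBelow : FiniteSet → ℕ → ℕ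
countBelow X t = length (filter (_<? t) (elements X))

noneBelow⇒countBelow≡0 : ∀ X {t} → NoneBelow X t → countBelow X t ≡ 0
noneBelow⇒countBelow≡0 X none =
  cong length (filter-none (_<? _) (All.tabulate λ u∈ → none _ u∈))

allBelow⇒countBelow : ∀ X {t} → (∀ u → u ∈ X → u < t) → countBelow X t ≡ ∣ X ∣
allBelow⇒countBelow X all = cong length (filter-all (_<? _) (All.tabulate λ u∈ → all _ u∈))

private
  module _ {t y : ℕ} where
    -- Nothing lies strictly between y and t, so y is the only element below t that is not below y.
    greatestBelow-length : ∀ {xs} → AllPairs _<_ xs → y ∈ˡ xs → y < t →
      (∀ u → u ∈ˡ xs → ¬ (y < u × u < t)) →
      length (filter (_<? t) xs) ≡ suc (length (filter (_<? y) xs))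
    greatestBelow-length {x ∷ xs} (x< ∷ _) (here refl) y<t gap
      rewrite filter-accept (_<? t) {xs = xs} y<t
            | filter-reject (_<? y) {x = y} {xs = xs} (<-irrefl refl)
            | filter-none (_<? t) {xs = xs} (All.tabulate λ u∈ u<t →
                gap _ (there u∈) (All.lookup x< u∈ , u<t))
            | filter-none (_<? y) {xs = xs} (All.tabulate λ u∈ → <-asym (All.lookup x< u∈))
      = refl
    greatestBelow-length {x ∷ xs} (x< ∷ xs↗) (there y∈) y<t gap
      rewrite filter-accept (_<? t) {xs = xs} (<-trans (All.lookup x< y∈) y<t)
            | filter-accept (_<? y) {xs = xs} (All.lookup x< y∈)
      = cong suc (greatestBelow-length xs↗ y∈ y<t (λ u → gap u ∘ there))

  greatestBelow-search : ∀ {t xs} → AllPairs _<_ xs →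
    (∀ u → u ∈ˡ xs → ¬ u < t) ⊎
    ∃ λ y → y ∈ˡ xs × y < t × (∀ u → u ∈ˡ xs → ¬ (y < u × u < t))
  greatestBelow-search [] = inj₁ λ _ ()
  greatestBelow-search {t} {x ∷ xs} (x< ∷ xs↗) with greatestBelow-search {t} xs↗
  ... | inj₂ (y , y∈ , y<t , gap) = inj₂ (y , there y∈ , y<t , λ where
    _ (here refl) (y<x , _) → <-asym y<x (All.lookup x< y∈)
    u (there u∈) → gap u u∈)
  ... | inj₁ none with x <? t
  ...   | yes x<t = inj₂ (x , here refl , x<t , λ where
    _ (here refl) (x<x , _) → <-irrefl refl x<x
    u (there u∈) (_ , u<t) → none u u∈ u<t)
  ...   | no x≮t = inj₁ λ where
    _ (here refl) → x≮t
    u (there u∈) → none u u∈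

greatestBelow⇒countBelow : ∀ X {t y} → GreatestBelow X t y →
                           countBelow X t ≡ suc (countBelow X y)
greatestBelow⇒countBelow X (y∈ , y<t , gap) = greatestBelow-length (increasing X) y∈ y<t gap

countBelow≡0⇒noneBelow : ∀ X {t} → countBelow X t ≡ 0 → NoneBelow X t
countBelow≡0⇒noneBelow X {t} eq with greatestBelow-search {t} (increasing X)
... | inj₁ none = none
... | inj₂ (y , greatest) with () ← trans (sym eq) (greatestBelow⇒countBelow X greatest)

countBelow≡suc⇒greatestBelow : ∀ X {t c} → countBelow X t ≡ suc c →
                               ∃ λ y → GreatestBelow X t y × countBelow X y ≡ c
countBelow≡suc⇒greatestBelow X {t} eq with greatestBelow-search {t} (increasing X)
... | inj₁ none with () ← trans (sym eq) (noneBelow⇒countBelow≡0 X none)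
... | inj₂ (y , greatest) =
  y , greatest , suc-injective (trans (sym (greatestBelow⇒countBelow X greatest)) eq)

-- The start t may lie outside X, so that a descent can begin above all of X. The number of steps is
-- fixed outside the formula and becomes its quantifier depth.
Descends : FiniteSet → ℕ → ℕ → ℕ → Set
Descends X zero    t y = t ≡ y
Descends X (suc c) t y = ∃ λ s → GreatestBelow X t s × Descends X c s y

descends⇒countBelow : ∀ X c {t y} → Descends X c t y → countBelow X t ≡ c + countBelow X y
descends⇒countBelow X zero    refl = refl
descends⇒countBelow X (suc c) (s , greatest , s↓y) =
  trans (greatestBelow⇒countBelow X greatest) (cong suc (descends⇒countBelow X c s↓y))

countBelow≡+⇒descends : ∀ X c {t d} → countBelow X t ≡ c + d →
                        ∃ λ y → Descends X c t y × countBelow X y ≡ d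
countBelow≡+⇒descends X zero    eq = _ , refl , eq
countBelow≡+⇒descends X (suc c) eq =
  let s , greatest , eq′ = countBelow≡suc⇒greatestBelow X eq
      y , s↓y , eq″ = countBelow≡+⇒descends X c eq′
  in y , (s , greatest , s↓y) , eq″

descends-≤ : ∀ X c {t y} → Descends X c t y → y ≤ t
descends-≤ X zero    refl = ≤-refl
descends-≤ X (suc c) (s , (_ , s<t , _) , s↓y) = ≤-trans (descends-≤ X c s↓y) (<⇒≤ s<t)

-- Definability

-- The environment type is arbitrary, rather than a pair of vectors, so that
-- the values of variables introduced by the extensions below are projections
-- and weakening (suc, in the indices) preserves values definitionally.

record Context : Set₁ where
  field
    Env         : Set
    {#num #set} : ℕ
    numbers     : Env → Vec ℕ #num
    sets        : Env → Vec FiniteSet #set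

open Context

Num : Context → Set
Num C = Fin (#num C)

Fset : Context → Set
Fset C = Fin (#set C)

num : (C : Context) → Env C → Num C → ℕ
num C a = lookup (numbers C a)

fset : (C : Context) → Env C → Fset C → FiniteSet
fset C a = lookup (sets C a)

infixl 5 _▸¹ _▸²

_▸¹ : Context → Context
C ▸¹ = record
  { Env     = Env C × ℕ
  ; numbers = λ (a , x) → x ∷ numbers C a
  ; sets    = λ (a , _) → sets C a
  }

_▸² : Context → Context
C ▸² = record
  { Env     = Env C × FiniteSet
  ; numbers = λ (a , _) → numbers C a
  ; sets    = λ (a , X) → X ∷ sets C a
  }

_▸¹*_ : Context → ℕ → Context
C ▸¹* k = record
  { Env     = Env C × Vec ℕ k
  ; numbers = λ (a , xs) → xs Vec.++ numbers C a
  ; sets    = λ (a , _) → sets C a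
  }

_▸²*_ : Context → ℕ → Context
C ▸²* k = record
  { Env     = Env C × Vec FiniteSet k
  ; numbers = λ (a , _) → numbers C a
  ; sets    = λ (a , Xs) → Xs Vec.++ sets C a
  }

data Reach (B : ℕ → Set) (E : ℕ → ℕ → Set) : ℕ → Set where
  base : ∀ {u} → B u → Reach B E u
  step : ∀ {u v} → Reach B E u → E u v → Reach B E v

-- The graph of a primitive recursion whose base and step are relations, so that partial functions
-- are covered.
data Iter (B : ℕ → Set) (G : ℕ → ℕ → ℕ → Set) : ℕ → ℕ → Set where
  base : ∀ {v} → B v → Iter B G 0 v
  step : ∀ {i v w} → Iter B G i v → G i v w → Iter B G (suc i) w

module Definability {σ : Signature} (M : Structure σ) where

  -- A superscript ᵈ marks a proof of definability: x <ᵈ y, for instance, proves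
  -- definable that the value of x is less than that of y.

  infixr 4 _,_

  record Def (C : Context) (P : Env C → Set) : Set where
    constructor _,_
    field
      formula : Formula σ (#num C) (#set C)
      correct : ∀ a → (M ⊨ formula [ numbers C a , sets C a ]) ⇔ P a

  open Def public

  private
    variable
      C : Context

  transport : {P Q : Env C → Set} → Def C P → (∀ a → P a ⇔ Q a) → Def C Q
  transport (φ , ⊨φ) P⇔Q = φ , λ a → mk⇔
    (to (P⇔Q a) ∘ to (⊨φ a)) (from (⊨φ a) ∘ from (P⇔Q a))

  infixr 6 _∧_
  infixr 5 _∨_
  infixr 4 _⇒_
  infix 3 _⇔ᵈ_
  infix 7 ¬ᵈ_
  infix 7 _∈ᵈ_ _<ᵈ_ _≡ᵈ_ _≤ᵈ_

  _<ᵈ_ : (x y : Num C) → Def C λ a → num C a x < num C a y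
  x <ᵈ y = less x y , λ _ → mk⇔ id id

  _∈ᵈ_ : (x : Num C) (X : Fset C) → Def C λ a → num C a x ∈ fset C a X
  x ∈ᵈ X = mem x X , λ _ → mk⇔ id id

  _∧_ : {P Q : Env C → Set} → Def C P → Def C Q → Def C λ a → P a × Q a
  (φ , ⊨φ) ∧ (ψ , ⊨ψ) = φ and ψ , λ a → mk⇔
    (λ (p , q) → to (⊨φ a) p , to (⊨ψ a) q)
    (λ (p , q) → from (⊨φ a) p , from (⊨ψ a) q)

  _∨_ : {P Q : Env C → Set} → Def C P → Def C Q → Def C λ a → P a ⊎ Q a
  (φ , ⊨φ) ∨ (ψ , ⊨ψ) = φ or ψ , λ a → mk⇔
    [ inj₁ ∘ to (⊨φ a) , inj₂ ∘ to (⊨ψ a) ]′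
    [ inj₁ ∘ from (⊨φ a) , inj₂ ∘ from (⊨ψ a) ]′

  _⇒_ : {P Q : Env C → Set} → Def C P → Def C Q → Def C λ a → P a → Q a
  (φ , ⊨φ) ⇒ (ψ , ⊨ψ) = φ imp ψ , λ a → mk⇔
    (λ f → to (⊨ψ a) ∘ f ∘ from (⊨φ a))
    (λ f → from (⊨ψ a) ∘ f ∘ to (⊨φ a))

  ¬ᵈ_ : {P : Env C → Set} → Def C P → Def C λ a → ¬ P a
  ¬ᵈ (φ , ⊨φ) = not φ , λ a → mk⇔ (_∘ from (⊨φ a)) (_∘ to (⊨φ a))

  _⇔ᵈ_ : {P Q : Env C → Set} → Def C P → Def C Q → Def C λ a → P a ⇔ Q a
  p ⇔ᵈ q = transport ((p ⇒ q) ∧ (q ⇒ p)) λ a → mk⇔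
    (λ (f , g) → mk⇔ f g) (λ p⇔q → to p⇔q , from p⇔q)

  ∃¹ : {P : Env C → ℕ → Set} → Def (C ▸¹) (λ (a , x) → P a x) →
       Def C λ a → ∃ λ x → P a x
  ∃¹ (φ , ⊨φ) = exists¹ φ , λ a → mk⇔
    (λ (x , p) → x , to (⊨φ (a , x)) p) (λ (x , p) → x , from (⊨φ (a , x)) p)

  ∀¹ : {P : Env C → ℕ → Set} → Def (C ▸¹) (λ (a , x) → P a x) →
       Def C λ a → ∀ x → P a x
  ∀¹ (φ , ⊨φ) = forall¹ φ , λ a → mk⇔
    (λ p x → to (⊨φ (a , x)) (p x)) (λ p x → from (⊨φ (a , x)) (p x))

  ∃² : {P : Env C → FiniteSet → Set} → Def (C ▸²) (λ (a , X) → P a X) →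
       Def C λ a → ∃ λ X → P a X
  ∃² (φ , ⊨φ) = exists² φ , λ a → mk⇔
    (λ (x , p) → x , to (⊨φ (a , x)) p) (λ (x , p) → x , from (⊨φ (a , x)) p)

  ∀² : {P : Env C → FiniteSet → Set} → Def (C ▸²) (λ (a , X) → P a X) →
       Def C λ a → ∀ X → P a X
  ∀² (φ , ⊨φ) = forall² φ , λ a → mk⇔
    (λ p x → to (⊨φ (a , x)) (p x)) (λ p x → from (⊨φ (a , x)) (p x))

  ∃¹* : ∀ {k} {P : Env C → Vec ℕ k → Set} → Def (C ▸¹* k) (λ (a , xs) → P a xs) →
        Def C λ a → ∃ λ xs → P a xs
  ∃¹* {k = zero} (φ , ⊨φ) = φ , λ a → mk⇔
    (λ p → [] , to (⊨φ (a , [])) p) λ { ([] , p) → from (⊨φ (a , [])) p }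
  ∃¹* {C} {k = suc k} {P} (φ , ⊨φ) = transport
    -- The head of the vector has index zero, so its quantifier is the innermost one.
    (∃¹* {C} {k} {λ a xs → ∃ λ x → P a (x ∷ xs)} (exists¹ φ , λ (a , xs) → mk⇔
      (λ (x , p) → x , to (⊨φ (a , x ∷ xs)) p)
      (λ (x , p) → x , from (⊨φ (a , x ∷ xs)) p)))
    λ a → mk⇔ (λ (xs , x , p) → x ∷ xs , p) λ { (x ∷ xs , p) → xs , x , p }

  ∀²* : ∀ {k} {P : Env C → Vec FiniteSet k → Set} →
        Def (C ▸²* k) (λ (a , Xs) → P a Xs) → Def C λ a → ∀ Xs → P a Xs
  ∀²* {k = zero} (φ , ⊨φ) = φ , λ a → mk⇔
    (λ { p [] → to (⊨φ (a , [])) p }) (λ p → from (⊨φ (a , [])) (p []))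
  ∀²* {C} {k = suc k} {P} (φ , ⊨φ) = transport
    (∀²* {C} {k} {λ a Xs → ∀ X → P a (X ∷ Xs)} (forall² φ , λ (a , Xs) → mk⇔
      (λ p X → to (⊨φ (a , X ∷ Xs)) (p X))
      (λ p X → from (⊨φ (a , X ∷ Xs)) (p X))))
    λ a → mk⇔ (λ { p (X ∷ Xs) → p Xs X }) (λ p Xs X → p (X ∷ Xs))

  -- The variable is quantified because C may contain none.
  ⊥ᵈ : Def C λ _ → ⊥
  ⊥ᵈ = transport (∃¹ (0F <ᵈ 0F)) λ _ → mk⇔ (λ (_ , x<x) → <-irrefl refl x<x) λ ()

  ⋀ : ∀ {n} {P : Env C → Fin n → Set} → (∀ i → Def C λ a → P a i) →
      Def C λ a → ∀ i → P a i
  ⋀ {n = zero} _ = transport (¬ᵈ ⊥ᵈ) λ _ → mk⇔ (λ _ ()) (λ _ ())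
  ⋀ {C} {n = suc n} {P} p = transport
    (p 0F ∧ ⋀ {C} {P = λ a i → P a (suc i)} λ i → p (suc i))
    λ a → mk⇔ (λ { (h , _) zero → h ; (_ , t) (suc i) → t i }) (λ f → f 0F , f ∘ suc)

  ⋁ : ∀ n {P : Env C → ℕ → Set} → (∀ c → c < n → Def C λ a → P a c) →
      Def C λ a → ∃ λ c → c < n × P a c
  ⋁ zero _ = transport ⊥ᵈ λ _ → mk⇔ (λ ()) (λ ())
  ⋁ {C} (suc n) {P} p = transport
    (p n ≤-refl ∨ ⋁ {C} n {P} λ c c<n → p c (m<n⇒m<1+n c<n)) λ a → mk⇔
    (λ { (inj₁ Pn) → n , ≤-refl , Pn ; (inj₂ (c , c<n , Pc)) → c , m<n⇒m<1+n c<n , Pc })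
    (λ (c , c<1+n , Pc) → [ (λ c<n → inj₂ (c , c<n , Pc)) ,
                            (λ { refl → inj₁ Pc }) ]′ (m<1+n⇒m<n∨m≡n c<1+n))

  _≤ᵈ_ : (x y : Num C) → Def C λ a → num C a x ≤ num C a y
  x ≤ᵈ y = transport (¬ᵈ (y <ᵈ x)) λ _ → mk⇔ ≮⇒≥ ≤⇒≯

  _≡ᵈ_ : (x y : Num C) → Def C λ a → num C a x ≡ num C a y
  x ≡ᵈ y = transport (x ≤ᵈ y ∧ y ≤ᵈ x) λ _ → mk⇔
    (λ (p , q) → ≤-antisym p q) (λ eq → ≤-reflexive eq , ≤-reflexive (sym eq))

  sucᵈ : (x y : Num C) → Def C λ a → suc (num C a x) ≡ num C a y
  sucᵈ x y = transport (x <ᵈ y ∧ ¬ᵈ (∃¹ (suc x <ᵈ 0F ∧ 0F <ᵈ suc y))) λ _ → mk⇔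
    (λ (x<y , gap) → ≤-antisym x<y (≮⇒≥ λ 1+x<y → gap (_ , ≤-refl , 1+x<y)))
    (λ eq → ≤-reflexive eq , λ (_ , x<u , u<y) →
      <⇒≱ x<u (≤-pred (subst (_ <_) (sym eq) u<y)))

  constᵈ : (c : ℕ) (x : Num C) → Def C λ a → c ≡ num C a x
  constᵈ zero x = transport (∀¹ (suc x ≤ᵈ 0F)) λ _ → mk⇔
    (λ p → sym (n≤0⇒n≡0 (p 0))) (λ { eq _ → subst (_≤ _) eq z≤n })
  constᵈ (suc c) x = transport (∃¹ (constᵈ c 0F ∧ sucᵈ 0F (suc x))) λ _ → mk⇔
    (λ { (_ , refl , eq) → eq }) (λ eq → c , refl , eq)

  ≪ᵈ : (X Z : Fset C) → Def C λ a → fset C a X ≪ fset C a Z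
  ≪ᵈ X Z = ∀¹ (0F ∈ᵈ X ⇒ ∀¹ (0F ∈ᵈ Z ⇒ 1F <ᵈ 0F))

  isUnionᵈ : (X Z U : Fset C) → Def C λ a → IsUnion (fset C a X) (fset C a Z) (fset C a U)
  isUnionᵈ X Z U = ∀¹ (0F ∈ᵈ U ⇔ᵈ (0F ∈ᵈ X ∨ 0F ∈ᵈ Z))

  -- Reachability by a well-founded relation is witnessed by the finite set
  -- of points of a path.
  reachᵈ : {B : Env C → ℕ → Set} {E : Env C → ℕ → ℕ → Set} →
           (∀ a → WellFounded (E a)) →
           Def (C ▸² ▸¹) (λ ((a , _) , v) → B a v) →
           Def (C ▸² ▸¹ ▸¹) (λ (((a , _) , v) , u) → E a u v) →
           (x : Num C) → Def C λ a → Reach (B a) (E a) (num C a x)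
  reachᵈ {C} {B} {E} wf b e x = transport
    (∃² (x ∈ᵈ 0F ∧ ∀¹ (0F ∈ᵈ 0F ⇒ (b ∨ ∃¹ (0F ∈ᵈ 0F ∧ e)))))
    λ a → mk⇔
      (λ (Y , x∈Y , closed) → closed⇒reach a Y closed (wf a _) x∈Y)
      (λ r → let ys , x∈ , closed = path a r in
        fromList ys , from (∈-fromList ys _) x∈ , λ v v∈ →
          [ inj₁
          , (λ (u , u∈ , Euv) → inj₂ (u , from (∈-fromList ys u) u∈ , Euv))
          ]′ (closed v (to (∈-fromList ys v) v∈)))
    where
    Closed : Env C → (ℕ → Set) → Set
    Closed a Y = ∀ v → Y v → B a v ⊎ ∃ λ u → Y u × E a u v

    -- Each point of Y is a starting point or has a predecessor in Y. Well-foundedness ends the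
    -- chain of predecessors and rules out points that only support each other in a cycle.
    closed⇒reach : ∀ a Y → Closed a (_∈ Y) → ∀ {v} → Acc (E a) v → v ∈ Y →
                   Reach (B a) (E a) v
    closed⇒reach a Y closed (acc rs) v∈ with closed _ v∈
    ... | inj₁ Bv = base Bv
    ... | inj₂ (u , u∈ , Euv) = step (closed⇒reach a Y closed (rs Euv) u∈) Euv

    path : ∀ a {v} → Reach (B a) (E a) v →
           ∃ λ ys → v ∈ˡ ys × Closed a (_∈ˡ ys)
    path a {v} (base Bv) = v ∷ [] , here refl , λ { _ (here refl) → inj₁ Bv }
    path a {v} (step {u} r Euv) =
      let ys , u∈ , closed = path a r in
      v ∷ ys , here refl , λ where
        _ (here refl)  → inj₂ (u , there u∈ , Euv)
        w (there w∈) → [ inj₁ , (λ (t , t∈ , Etw) → inj₂ (t , there t∈ , Etw)) ]′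
                          (closed w w∈)

  greatestBelowᵈ : (X : Fset C) (t y : Num C) →
                   Def C λ a → GreatestBelow (fset C a X) (num C a t) (num C a y)
  greatestBelowᵈ X t y =
    y ∈ᵈ X ∧ y <ᵈ t ∧ ∀¹ (0F ∈ᵈ X ⇒ ¬ᵈ (suc y <ᵈ 0F ∧ 0F <ᵈ suc t))

  descendsᵈ : (X : Fset C) (c : ℕ) (t y : Num C) →
              Def C λ a → Descends (fset C a X) c (num C a t) (num C a y)
  descendsᵈ X zero    t y = t ≡ᵈ y
  descendsᵈ X (suc c) t y = ∃¹ (greatestBelowᵈ X (suc t) 0F ∧ descendsᵈ X c 0F (suc y))

  -- Remove c elements from the top of X, then p elements at a time.
  progressionᵈ : (c p : ℕ) (X : Fset C) →
                 Def C λ a → ∃ λ q → ∣ fset C a X ∣ ≡ c + q * p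
  progressionᵈ {C} c p X = transport
    (∃¹ (∀¹ (0F ∈ᵈ X ⇒ 0F <ᵈ 1F) ∧
      ∃¹ (descendsᵈ X c 1F 0F ∧
        reachᵈ {B = λ a → NoneBelow (set a)} {E = λ a → Jump (set a)} wf
          (∀¹ (0F ∈ᵈ suc X ⇒ ¬ᵈ (0F <ᵈ 1F)))
          (descendsᵈ (suc X) p 1F 0F ∧ 0F <ᵈ 1F) 0F)))
    λ a → mk⇔ (sound (fset C a X)) (complete (fset C a X))
    where
    -- The condition u < v makes the relation well-founded even if p = 0.
    Jump : FiniteSet → ℕ → ℕ → Set
    Jump X u v = Descends X p v u × u < v

    set : Env (C ▸¹ ▸¹) → FiniteSet
    set ((a , _) , _) = fset C a X

    wf : ∀ a → WellFounded (Jump (set a))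
    wf a = Subrelation.wellFounded proj₂ <-wellFounded

    reach⇒ : ∀ X {t} → Reach (NoneBelow X) (Jump X) t → ∃ λ q → countBelow X t ≡ q * p
    reach⇒ X (base none) = 0 , noneBelow⇒countBelow≡0 X none
    reach⇒ X (step r (desc , _)) =
      let q , eq = reach⇒ X r in
      suc q , trans (descends⇒countBelow X p desc) (cong (p +_) eq)

    ⇒reach : ∀ X q {t} → countBelow X t ≡ q * p → Reach (NoneBelow X) (Jump X) t
    ⇒reach X zero eq = base (countBelow≡0⇒noneBelow X eq)
    ⇒reach X (suc q) {t} eq with countBelow≡+⇒descends X p eq
    ... | y , desc , eq′ with m≤n⇒m<n∨m≡n (descends-≤ X p desc)
    ...   | inj₁ y<t  = step (⇒reach X q eq′) (desc , y<t)
    -- A descent that does not move has p = 0, and the remaining q steps are made from the same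
    -- point.
    ...   | inj₂ refl = ⇒reach X q eq′

    sound : ∀ X → (∃ λ t → (∀ u → u ∈ X → u < t) ×
              ∃ λ y → Descends X c t y × Reach (NoneBelow X) (Jump X) y) →
            ∃ λ q → ∣ X ∣ ≡ c + q * p
    sound X (t , all , y , desc , r) =
      let q , eq = reach⇒ X r in
      q , trans (sym (allBelow⇒countBelow X all))
                (trans (descends⇒countBelow X c desc) (cong (c +_) eq))

    complete : ∀ X → (∃ λ q → ∣ X ∣ ≡ c + q * p) →
               ∃ λ t → (∀ u → u ∈ X → u < t) ×
                 ∃ λ y → Descends X c t y × Reach (NoneBelow X) (Jump X) y
    complete X (q , eq) =
      let all = λ u → <upperBound X {u}
          y , desc , eq′ = countBelow≡+⇒descends X c
                             (trans (allBelow⇒countBelow X all) eq)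
      in upperBound X , all , y , desc , ⇒reach X q eq′

  -- A progression with period zero has c as its only member.
  ∣_∣≡constᵈ : (X : Fset C) (c : ℕ) → Def C λ a → ∣ fset C a X ∣ ≡ c
  ∣ X ∣≡constᵈ c = transport (progressionᵈ c 0 X) λ _ → mk⇔
    (λ (q , eq) → trans eq (trans (cong (c +_) (*-zeroʳ q)) (+-identityʳ c)))
    (λ eq → 0 , trans eq (sym (+-identityʳ c)))

-- Equicardinality

map-lookup-↑ˡ : ∀ {A : Set} {m n} (xs : Vec A n) (ys : Vec A m) →
                map (lookup (xs Vec.++ ys)) (map (_↑ˡ m) (allFin n)) ≡ xs
map-lookup-↑ˡ xs ys = trans (sym (map-∘ _ _ _))
  (trans (map-cong (lookup-++ˡ xs ys) (allFin _)) (map-lookup-allFin xs))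

-- Ranging over all contexts and variables makes R available below any quantifiers without
-- substitution in formulas.
DefinableRelation : ∀ {σ n} → Structure σ → SetRelation n → Set₁
DefinableRelation {n = n} M R =
  ∀ {C} (Xs : Vec (Fset C) n) → Definability.Def M C λ a → R (map (fset C a) Xs)

DefinableEquicardinality : ∀ {σ} → Structure σ → Set₁
DefinableEquicardinality M =
  ∀ {C} (X Y : Fset C) → Definability.Def M C λ a → ∣ fset C a X ∣ ≡ ∣ fset C a Y ∣

-- The segment stands for all sets with c elements, which a cardinality relation cannot tell apart.
slice : ∀ {n} → SetRelation (suc n) → ℕ → SetRelation n
slice R c Xs = R (segment c ∷ Xs)

Congruent : ∀ {n} → SetRelation (suc n) → ℕ → ℕ → Set
Congruent R a b = ∀ x Xs → slice R (a + x) Xs ⇔ slice R (b + x) Xs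

module _ {n} {R : SetRelation (suc n)} (R-card : IsCardinalityRelation R) where

  head-card : ∀ {X Y Xs} → ∣ X ∣ ≡ ∣ Y ∣ → R (X ∷ Xs) ⇔ R (Y ∷ Xs)
  head-card eq = R-card _ _ λ { zero → eq ; (suc _) → refl }

  slice-⇔ : ∀ X {Xs c} → ∣ X ∣ ≡ c → R (X ∷ Xs) ⇔ slice R c Xs
  slice-⇔ X eq = head-card (trans eq (sym (∣interval∣ 0 _)))

  slice-card : ∀ c → IsCardinalityRelation (slice R c)
  slice-card c Xs Ys eq = R-card _ _ λ { zero → refl ; (suc i) → eq i }

  module _ {σ} {M : Structure σ} (Rᵈ : DefinableRelation M R) where
    open Definability M

    -- Any set W with c elements can replace the segment, and having c elements is definable from
    -- the order.
    sliceᵈ : ∀ c → DefinableRelation M (slice R c)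
    sliceᵈ c {C} Xs = transport
      (∃² (∣ 0F ∣≡constᵈ c ∧ Rᵈ (0F ∷ map suc Xs)))
      λ a → mk⇔
        (λ (W , eq , p) → to (slice-⇔ W eq) (subst (λ Ys → R (W ∷ Ys)) (weaken a W) p))
        (λ p → segment c , ∣interval∣ 0 c ,
          subst (λ Ys → R (segment c ∷ Ys)) (sym (weaken a (segment c))) p)
      where
      weaken : ∀ a W → map (fset (C ▸²) (a , W)) (map suc Xs) ≡ map (fset C a) Xs
      weaken a W = sym (map-∘ _ _ Xs)

    -- A set Z beyond X and Y is disjoint from both and can have any number x of elements. The
    -- unions then have `∣ X ∣ + x` and `∣ Y ∣ + x` elements, so the formula expresses that the two
    -- cardinalities are congruent.
    equicardinalᵈ : (∀ a b → Congruent R a b → a ≡ b) → DefinableEquicardinality M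
    equicardinalᵈ separated {C} X Y = transport
      (∀² (≪ᵈ (suc X) 0F ⇒ ≪ᵈ (suc Y) 0F ⇒
        ∀² (isUnionᵈ (suc (suc X)) 1F 0F ⇒
          ∀² (isUnionᵈ (suc (suc (suc Y))) 2F 0F ⇒
            ∀²* (R∷ᵈ 1F ⇔ᵈ R∷ᵈ 0F)))))
      λ a → mk⇔ (λ p → separated _ _ (complete (fset C a X) (fset C a Y) p))
              (sound (fset C a X) (fset C a Y))
      where
      R∷ᵈ : ∀ {C} (U : Fset C) → Def (C ▸²* n) λ (a , Xs) → R (fset C a U ∷ Xs)
      R∷ᵈ {C} U = transport (Rᵈ ((n ↑ʳ U) ∷ map (_↑ˡ #set C) (allFin n)))
        λ (a , Xs) → let
          eq = cong₂ _∷_ (lookup-++ʳ Xs (sets C a) U) (map-lookup-↑ˡ Xs (sets C a))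
          in mk⇔ (subst R eq) (subst R (sym eq))

      Indistinguishable : FiniteSet → FiniteSet → Set
      Indistinguishable X Y =
        ∀ Z → X ≪ Z → Y ≪ Z → ∀ U → IsUnion X Z U → ∀ V → IsUnion Y Z V →
        ∀ Xs → R (U ∷ Xs) ⇔ R (V ∷ Xs)

      sound : ∀ X Y → ∣ X ∣ ≡ ∣ Y ∣ → Indistinguishable X Y
      sound X Y eq Z X≪Z Y≪Z U U=X∪Z V V=Y∪Z Xs = head-card
        (trans (∣union∣ {X} {Z} {U} X≪Z U=X∪Z)
          (trans (cong (_+ ∣ Z ∣) eq) (sym (∣union∣ {Y} {Z} {V} Y≪Z V=Y∪Z))))

      complete : ∀ X Y → Indistinguishable X Y → Congruent R ∣ X ∣ ∣ Y ∣
      complete X Y same x Xs =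
        slice-⇔ (append Y Z Y≪Z) (∣append∣ Y Y≪Z)
        ⇔-∘ same Z X≪Z Y≪Z (append X Z X≪Z) (append-isUnion X Z X≪Z)
              (append Y Z Y≪Z) (append-isUnion Y Z Y≪Z) Xs
        ⇔-∘ ⇔-sym (slice-⇔ (append X Z X≪Z) (∣append∣ X X≪Z))
        where
        bound : ℕ
        bound = upperBound X ⊔ upperBound Y

        Z : FiniteSet
        Z = interval bound x

        beyond : ∀ W → upperBound W ≤ bound → W ≪ Z
        beyond W W≤ u u∈ v v∈ =
          <-≤-trans (<upperBound W u∈) (≤-trans W≤ (proj₁ (to (∈-interval bound x v) v∈)))

        X≪Z : X ≪ Z
        X≪Z = beyond X (m≤m⊔n (upperBound X) (upperBound Y))

        Y≪Z : Y ≪ Z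
        Y≪Z = beyond Y (m≤n⊔m (upperBound X) (upperBound Y))

        ∣append∣ : ∀ W (W≪Z : W ≪ Z) → ∣ append W Z W≪Z ∣ ≡ ∣ W ∣ + x
        ∣append∣ W W≪Z = trans (∣union∣ {W} {Z} {append W Z W≪Z} W≪Z (append-isUnion W Z W≪Z))
          (cong (∣ W ∣ +_) (∣interval∣ bound x))

  module _ {a p} (periodic : Congruent R a (a + suc p)) where

    -- Adding `c ∸ a` to both sides carries the congruence from a to any c beyond it; it is then
    -- iterated q times.
    slice-shift : ∀ q {c Xs} → a ≤ c → slice R c Xs ⇔ slice R (c + q * suc p) Xs
    slice-shift zero {c} {Xs} a≤c rewrite +-identityʳ c = ⇔-id _
    slice-shift (suc q) {c} {Xs} a≤c =
      subst (λ d → slice R (c + suc p) Xs ⇔ slice R d Xs) (+-assoc c (suc p) (q * suc p))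
        (slice-shift q (≤-trans a≤c (m≤m+n c (suc p))))
      ⇔-∘ shift
      where
      shift : slice R c Xs ⇔ slice R (c + suc p) Xs
      shift = subst (λ d → slice R c Xs ⇔ slice R d Xs)
        (trans (+-assoc a (suc p) (c ∸ a)) (trans (cong (a +_) (+-comm (suc p) (c ∸ a)))
          (trans (sym (+-assoc a (c ∸ a) (suc p))) (cong (_+ suc p) (m+[n∸m]≡n a≤c)))))
        (subst (λ d → slice R d Xs ⇔ slice R (a + suc p + (c ∸ a)) Xs) (m+[n∸m]≡n a≤c)
          (periodic (c ∸ a) Xs))

    -- The class of c is c + periodAt c · ℕ, a singleton if the period is zero.
    periodAt : ℕ → ℕ
    periodAt c with c <? a
    ... | yes _ = 0
    ... | no  _ = suc p

    periodAt-⇔ : ∀ c q {Xs} → slice R c Xs ⇔ slice R (c + q * periodAt c) Xs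
    periodAt-⇔ c q with c <? a
    ... | yes _   rewrite *-zeroʳ q | +-identityʳ c = ⇔-id _
    ... | no  c≮a = slice-shift q (≮⇒≥ c≮a)

    -- Below a every number represents itself; from a on, the distance to a is reduced modulo the
    -- period.
    representative : ∀ x → ∃ λ c → c < a + suc p × ∃ λ q → x ≡ c + q * periodAt c
    representative x with x <? a
    ... | yes x<a = x , <-≤-trans x<a (m≤m+n a (suc p)) , 0 , sym (+-identityʳ x)
    ... | no  x≮a = a + r , +-monoʳ-< a (m%n<n d (suc p)) , q , x≡
      where
      d = x ∸ a
      r = d % suc p
      q = d / suc p

      periodAt≡ : periodAt (a + r) ≡ suc p
      periodAt≡ with a + r <? a
      ... | yes a+r<a = ⊥-elim (≤⇒≯ (m≤m+n a r) a+r<a)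
      ... | no  _     = refl

      x≡ : x ≡ a + r + q * periodAt (a + r)
      x≡ rewrite periodAt≡ = trans (sym (m+[n∸m]≡n (≮⇒≥ x≮a)))
        (trans (cong (a +_) (m≡m%n+[m/n]*n d (suc p))) (sym (+-assoc a r _)))

    module _ {σ} {N : Structure σ} where
      open Definability N

      -- The class of the first argument is recognized by `progressionᵈ`, which uses the order only,
      -- and within a class R coincides with the slice at the representative.
      periodicᵈ : (∀ c → c < a + suc p → DefinableRelation N (slice R c)) →
                  DefinableRelation N R
      periodicᵈ sᵈ (X ∷ Xs) = transport
        (⋁ (a + suc p) λ c c<b → sᵈ c c<b Xs ∧ progressionᵈ c (periodAt c) X)
        λ e → mk⇔
          (λ (c , _ , Rc , q , eq) → from (slice-⇔ _ eq) (to (periodAt-⇔ c q) Rc))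
          (λ Rx → let c , c<b , q , eq = representative _ in
            c , c<b , from (periodAt-⇔ c q) (to (slice-⇔ _ eq) Rx) , q , eq)

-- Equicardinality in M or definability in N

search : ∀ {a b} {A : Set a} {B : ℕ → Set b} → (∀ c → A ⊎ B c) →
         ∀ n → A ⊎ (∀ c → c < n → B c)
search f zero = inj₂ λ _ ()
search f (suc n) with f n | search f n
... | inj₁ a | _      = inj₁ a
... | inj₂ _ | inj₁ a = inj₁ a
... | inj₂ b | inj₂ g =
  inj₂ λ c c<1+n → [ g c , (λ { refl → b }) ]′ (m<1+n⇒m<n∨m≡n c<1+n)

-- Induction on the arity. At arity zero R is a fixed truth value. If two distinct numbers are
-- congruent, finitely many slices determine R: either one of them yields equicardinality, or all
-- are definable in N and hence R is.
dichotomy : ExcludedMiddle 0ℓ → ∀ {σ τ} {M : Structure σ} {N : Structure τ} →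
            ∀ n {R : SetRelation n} → IsCardinalityRelation R → DefinableRelation M R →
            DefinableEquicardinality M ⊎ DefinableRelation N R
dichotomy em {N = N} zero {R} _ _ with em {R []}
... | yes R[] = inj₂ λ { [] → transport (¬ᵈ ⊥ᵈ) λ _ → mk⇔ (λ _ → R[]) (λ _ ()) }
  where open Definability N
... | no ¬R[] = inj₂ λ { [] → transport ⊥ᵈ λ _ → mk⇔ (λ ()) ¬R[] }
  where open Definability N
dichotomy em {M = M} {N} (suc n) {R} R-card Rᵈ
  with em {∃ λ a → ∃ λ p → Congruent R a (a + suc p)}
... | yes (a , p , periodic) = combine
  (search (λ c → dichotomy em n (slice-card R-card c) (sliceᵈ R-card Rᵈ c)) (a + suc p))
  where
  combine : DefinableEquicardinality M ⊎
              (∀ c → c < a + suc p → DefinableRelation N (slice R c)) →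
            DefinableEquicardinality M ⊎ DefinableRelation N R
  combine (inj₁ ∣∣≡ᵈ)    = inj₁ ∣∣≡ᵈ
  combine (inj₂ slicesᵈ) = inj₂ (periodicᵈ R-card periodic slicesᵈ)
... | no ¬periodic = inj₁ (equicardinalᵈ R-card Rᵈ separated)
  where
  ordered : ∀ {a b} → a < b → ¬ Congruent R a b
  -- The difference of the two congruent numbers is the period `suc p`, so p is `b ∸ suc a`.
  ordered {a} {b} a<b a~b = ¬periodic (a , b ∸ suc a ,
    subst (Congruent R a) (sym (trans (+-suc a (b ∸ suc a)) (m+[n∸m]≡n a<b))) a~b)

  separated : ∀ a b → Congruent R a b → a ≡ b
  separated a b a~b with <-cmp a b
  ... | tri< a<b _ _ = ⊥-elim (ordered a<b a~b)
  ... | tri≈ _ a≡b _ = a≡b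
  ... | tri> _ _ b<a = ⊥-elim (ordered b<a λ x Xs → ⇔-sym (a~b x Xs))

-- Arithmetic, recursive functions and codes of formulas

multiples : (x : ℕ) .{{_ : NonZero x}} → ℕ → FiniteSet
multiples x q = mkFiniteSet (applyUpTo (_* x) q)
  (AllPairs.applyUpTo⁺₁ (_* x) q λ i<j _ → *-monoˡ-< x i<j)

∈-multiples : ∀ x .{{_ : NonZero x}} q u →
              u ∈ multiples x q ⇔ (u < q * x × ∃ λ i → u ≡ i * x)
∈-multiples x q u = mk⇔
  (λ u∈ → let i , i<q , u≡ = ∈-applyUpTo⁻ (_* x) u∈ in
    subst (_< q * x) (sym u≡) (*-monoˡ-< x i<q) , i , u≡)
  (λ { (u<qx , i , refl) → ∈-applyUpTo⁺ (_* x) (*-cancelʳ-< x i q u<qx) })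

-- This determines `triangle n` by addition and multiplication alone, which makes `pair` definable.
double-triangle : ∀ n → triangle n + triangle n ≡ n * suc n
double-triangle zero    = refl
double-triangle (suc n) = trans
  (solve 2 (λ m t → (con 1 :+ m :+ t) :+ (con 1 :+ m :+ t)
    := (t :+ t) :+ (con 2 :+ (m :+ m))) refl n (triangle n))
  (trans (cong (_+ (2 + (n + n))) (double-triangle n))
    (solve 1 (λ m → m :* (con 1 :+ m) :+ (con 2 :+ (m :+ m))
      := (con 1 :+ m) :* (con 2 :+ m)) refl n))
  where open +-*-Solver

double-injective : ∀ m n → m + m ≡ n + n → m ≡ n
double-injective m n eq with <-cmp m n
... | tri< m<n _ _ = ⊥-elim (<-irrefl eq (+-mono-< m<n m<n))
... | tri≈ _ m≡n _ = m≡n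
... | tri> _ _ n<m = ⊥-elim (<-irrefl (sym eq) (+-mono-< n<m n<m))

triangle-mono-≤ : ∀ {m n} → m ≤ n → triangle m ≤ triangle n
triangle-mono-≤ z≤n       = z≤n
triangle-mono-≤ (s≤s m≤n) = +-mono-≤ (s≤s m≤n) (triangle-mono-≤ m≤n)

-- As y is at most `x + y`, the value stays below `triangle (suc (x + y))`, where the next diagonal
-- begins.
pair-<-diagonal : ∀ x y x′ y′ → x + y < x′ + y′ → pair x y < pair x′ y′
pair-<-diagonal x y x′ y′ lt = <-≤-trans
  (subst (_< suc (x + y) + triangle (x + y)) (+-comm y _)
    (+-monoˡ-< (triangle (x + y)) (s≤s (m≤n+m y x))))
  (≤-trans (triangle-mono-≤ lt) (m≤m+n _ y′))

pair-injective : ∀ x y x′ y′ → pair x y ≡ pair x′ y′ → x ≡ x′ × y ≡ y′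
pair-injective x y x′ y′ eq with <-cmp (x + y) (x′ + y′)
... | tri< lt _ _ = ⊥-elim (<-irrefl eq (pair-<-diagonal x y x′ y′ lt))
... | tri> _ _ gt = ⊥-elim (<-irrefl (sym eq) (pair-<-diagonal x′ y′ x y gt))
... | tri≈ _ s≡ _ = +-cancelʳ-≡ y x x′ (trans s≡ (cong (x′ +_) (sym y≡))) , y≡
  where
  y≡ : y ≡ y′
  y≡ = +-cancelˡ-≡ (triangle (x + y)) y y′ (trans eq (cong (λ s → triangle s + y′) (sym s≡)))

-- In the case of `min`, f would be both zero and positive at the smaller of two distinct results.
⇓-functional : ∀ {n} {f : Rec n} {xs y z} → f [ xs ]⇓ y → f [ xs ]⇓ z → y ≡ z
⇓-functional zero⇓ zero⇓ = refl
⇓-functional succ⇓ succ⇓ = refl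
⇓-functional (proj⇓ i) (proj⇓ .i) = refl
⇓-functional (comp⇓ {f = f} ys gs⇓ys f⇓) (comp⇓ zs gs⇓zs f⇓′)
  with refl ← Pointwise-≡⇒≡ (ext {xs = ys} {ys = zs}
                λ i → ⇓-functional (gs⇓ys i) (gs⇓zs i)) =
  ⇓-functional f⇓ f⇓′
⇓-functional (prec⇓-zero f⇓) (prec⇓-zero f⇓′) = ⇓-functional f⇓ f⇓′
⇓-functional (prec⇓-suc h⇓ g⇓) (prec⇓-suc h⇓′ g⇓′)
  with refl ← ⇓-functional h⇓ h⇓′ = ⇓-functional g⇓ g⇓′
⇓-functional (min⇓ {y = y} f⇓ below) (min⇓ {y = z} f⇓′ below′) with <-cmp y z
... | tri< y<z _ _ with () ← ⇓-functional f⇓ (proj₂ (below′ y y<z))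
... | tri≈ _ y≡z _ = y≡z
... | tri> _ _ z<y with () ← ⇓-functional f⇓′ (proj₂ (below z z<y))

zero⇔ : ∀ {n} {xs : Vec ℕ n} {y} → 0 ≡ y ⇔ zero [ xs ]⇓ y
zero⇔ = mk⇔ (λ { refl → zero⇓ }) (λ { zero⇓ → refl })

succ⇔ : ∀ {x y} → suc x ≡ y ⇔ succ [ x ∷ [] ]⇓ y
succ⇔ = mk⇔ (λ { refl → succ⇓ }) (λ { succ⇓ → refl })

proj⇔ : ∀ {n} {xs : Vec ℕ n} {y} i → lookup xs i ≡ y ⇔ proj i [ xs ]⇓ y
proj⇔ i = mk⇔ (λ { refl → proj⇓ i }) (λ { (proj⇓ _) → refl })

comp⇔ : ∀ {n k} {f : Rec k} {gs : Vec (Rec n) k} {xs y} →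
        (∃ λ ys → (∀ i → lookup gs i [ xs ]⇓ lookup ys i) × f [ ys ]⇓ y) ⇔ comp f gs [ xs ]⇓ y
comp⇔ = mk⇔ (λ (ys , gs⇓ , f⇓) → comp⇓ ys gs⇓ f⇓) (λ { (comp⇓ ys gs⇓ f⇓) → ys , gs⇓ , f⇓ })

prec⇔ : ∀ {n} {f : Rec n} {g xs x y} →
        Iter (f [ xs ]⇓_) (λ i v w → g [ i ∷ v ∷ xs ]⇓ w) x y ⇔ prec f g [ x ∷ xs ]⇓ y
prec⇔ {f = f} {g} {xs} = mk⇔ iter⇒ ⇒iter
  where
  iter⇒ : ∀ {x y} → Iter (f [ xs ]⇓_) (λ i v w → g [ i ∷ v ∷ xs ]⇓ w) x y →
          prec f g [ x ∷ xs ]⇓ y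
  iter⇒ (base f⇓)    = prec⇓-zero f⇓
  iter⇒ (step it g⇓) = prec⇓-suc (iter⇒ it) g⇓

  ⇒iter : ∀ {x y} → prec f g [ x ∷ xs ]⇓ y →
          Iter (f [ xs ]⇓_) (λ i v w → g [ i ∷ v ∷ xs ]⇓ w) x y
  ⇒iter (prec⇓-zero f⇓)   = base f⇓
  ⇒iter (prec⇓-suc h⇓ g⇓) = step (⇒iter h⇓) g⇓

-- The output of f is bound as a variable, equated with 0 or `suc v`, since the formula for f takes
-- its output in a variable.
min⇔ : ∀ {n} {f : Rec (suc n)} {xs y} →
       ((∃ λ z → 0 ≡ z × f [ y ∷ xs ]⇓ z) ×
        (∀ x → x < y → ∃ λ v → ∃ λ w → suc v ≡ w × f [ x ∷ xs ]⇓ w)) ⇔ min f [ xs ]⇓ y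
min⇔ = mk⇔
  (λ { ((_ , refl , f⇓) , below) →
    min⇓ f⇓ λ x x<y → let v , _ , eq , f⇓′ = below x x<y in v , subst (_ [ _ ]⇓_) (sym eq) f⇓′ })
  (λ { (min⇓ f⇓ below) → (0 , refl , f⇓) , λ x x<y →
    let v , f⇓′ = below x x<y in v , suc v , refl , f⇓′ })

-- Symbolic codes: the code of even a short formula is a number far too large
-- to be evaluated, as comparing codes as numbers would do.

data Code : Set where
  leaf : ℕ → Code
  _∙_  : Code → Code → Code

infixr 5 _∙_

value : Code → ℕ
value (leaf n) = n
value (c ∙ d)  = pair (value c) (value d)

-- As a record, two instances are compared by φ and c, without evaluating the numbers.
record HasCode {σ m k} (φ : Formula σ m k) (c : Code) : Set where
  constructor hasCode
  field
    proof : ⌜ φ ⌝ ≡ value c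

module _ {σ : Signature} {m k : ℕ} where

  less-code : ∀ (i j : Fin m) {x y} → toℕ i ≡ x → toℕ j ≡ y →
              HasCode {σ} {m} {k} (less i j) (leaf 0 ∙ leaf x ∙ leaf y)
  less-code _ _ refl refl = hasCode refl

  not-code : ∀ {φ : Formula σ m k} {c} → HasCode φ c → HasCode (not φ) (leaf 3 ∙ c)
  not-code (hasCode eq) = hasCode (cong (pair 3) eq)

  and-code : ∀ {φ ψ : Formula σ m k} {c d} → HasCode φ c → HasCode ψ d →
             HasCode (φ and ψ) (leaf 4 ∙ c ∙ d)
  and-code (hasCode eq) (hasCode eq′) = hasCode (cong₂ (λ x y → pair 4 (pair x y)) eq eq′)

  exists¹-code : ∀ {φ : Formula σ (suc m) k} {c} →
                 HasCode φ c → HasCode (exists¹ φ) (leaf 7 ∙ c)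
  exists¹-code (hasCode eq) = hasCode (cong (pair 7) eq)

  forall¹-code : ∀ {φ : Formula σ (suc m) k} {c} →
                 HasCode φ c → HasCode (forall¹ φ) (leaf 8 ∙ c)
  forall¹-code (hasCode eq) = hasCode (cong (pair 8) eq)

-- Code of the formula defining n, from the codes z of the formula defining 0
-- and s of the formula defining the graph of the successor function.

numeralCode : Code → Code → ℕ → Code
numeralCode z s zero    = z
numeralCode z s (suc n) = leaf 7 ∙ leaf 4 ∙ numeralCode z s n ∙ s

-- The values are recorded apart from the variables, so that weakening
-- preserves them definitionally.

record Tuple (C : Context) (n : ℕ) : Set where
  field
    vars   : Vec (Num C) n
    values : Env C → Vec ℕ n
    agree  : ∀ a → map (num C a) vars ≡ values a

open Tuple

tuple : ∀ {C n} → Vec (Num C) n → Tuple C n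
tuple {C} xs = record { vars = xs ; values = λ a → map (num C a) xs ; agree = λ _ → refl }

infixr 5 _∷ᵗ_
infix 6 _↑¹ _↑² _↑¹*_

_∷ᵗ_ : ∀ {C n} → Num C → Tuple C n → Tuple C (suc n)
_∷ᵗ_ {C} x v = record
  { vars   = x ∷ vars v
  ; values = λ a → num C a x ∷ values v a
  ; agree  = λ a → cong (num C a x ∷_) (agree v a)
  }

_↑¹ : ∀ {C n} → Tuple C n → Tuple (C ▸¹) n
v ↑¹ = record
  { vars   = map suc (vars v)
  ; values = λ (a , _) → values v a
  ; agree  = λ (a , _) → trans (sym (map-∘ _ suc (vars v))) (agree v a)
  }

_↑² : ∀ {C n} → Tuple C n → Tuple (C ▸²) n
v ↑² = record
  { vars   = vars v
  ; values = λ (a , _) → values v a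
  ; agree  = λ (a , _) → agree v a
  }

_↑¹*_ : ∀ {C n} → Tuple C n → ∀ k → Tuple (C ▸¹* k) n
_↑¹*_ {C} v k = record
  { vars   = map (k ↑ʳ_) (vars v)
  ; values = λ (a , _) → values v a
  ; agree  = λ (a , xs) → trans (sym (map-∘ _ (k ↑ʳ_) (vars v)))
      (trans (map-cong (lookup-++ʳ xs (numbers C a)) (vars v)) (agree v a))
  }

newest : ∀ {C} k → Tuple (C ▸¹* k) k
newest {C} k = record
  { vars   = map (_↑ˡ #num C) (allFin k)
  ; values = λ (_ , xs) → xs
  ; agree  = λ (a , xs) → map-lookup-↑ˡ xs (numbers C a)
  }

-- Definability of arithmetic and of recursive functions

module Arithmetic {σ} {M : Structure σ} (∣∣≡ᵈ : DefinableEquicardinality M) where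
  open Definability M

  private
    variable
      C : Context

  -- X is compared with the set of numbers below y, which the order defines.
  cardᵈ : (X : Fset C) (y : Num C) → Def C λ a → ∣ fset C a X ∣ ≡ num C a y
  cardᵈ X y = transport (∃² (∀¹ (0F ∈ᵈ 0F ⇔ᵈ 0F <ᵈ suc y) ∧ ∣∣≡ᵈ (suc X) 0F))
    λ _ → mk⇔
      (λ (W , W≡ , eq) → trans eq (trans
        (∣∣-ext W (segment _) λ u → ⇔-sym (∈-segment _ u) ⇔-∘ W≡ u)
        (∣interval∣ 0 _)))
      (λ eq → segment _ , ∈-segment _ , trans eq (sym (∣interval∣ 0 _)))

  +ᵈ : (x y z : Num C) → Def C λ a → num C a x + num C a y ≡ num C a z
  +ᵈ x y z = transport
    (x ≤ᵈ z ∧ ∃² (∀¹ (0F ∈ᵈ 0F ⇔ᵈ (suc x ≤ᵈ 0F ∧ 0F <ᵈ suc z)) ∧ cardᵈ 0F y))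
    λ _ → mk⇔ sound complete
    where
    Interval : ℕ → ℕ → ℕ → Set
    Interval x y z = x ≤ z × ∃ λ W → (∀ u → u ∈ W ⇔ (x ≤ u × u < z)) × ∣ W ∣ ≡ y

    sound : ∀ {x y z} → Interval x y z → x + y ≡ z
    sound {x} {y} {z} (x≤z , W , W≡ , eq) = trans (cong (x +_) y≡) (m+[n∸m]≡n x≤z)
      where
      y≡ : y ≡ z ∸ x
      y≡ = trans (sym eq) (trans
        (∣∣-ext W (interval x (z ∸ x)) λ u →
          ⇔-sym (∈-interval x (z ∸ x) u)
          ⇔-∘ subst⇔ (λ b → x ≤ u × u < b) (sym (m+[n∸m]≡n x≤z))
          ⇔-∘ W≡ u)
        (∣interval∣ x (z ∸ x)))

    complete : ∀ {x y z} → x + y ≡ z → Interval x y z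
    complete {x} {y} refl = m≤m+n x y , interval x y , ∈-interval x y , ∣interval∣ x y

  -- Multiples are the points reachable from 0 by jumps of length x. Requiring jumps to increase
  -- keeps them well-founded for x = 0, where 0 is the only multiple.
  multipleᵈ : (x u : Num C) → Def C λ a → ∃ λ q → num C a u ≡ q * num C a x
  multipleᵈ {C} x u = transport
    (reachᵈ {E = λ a → Jump (num C a x)} (λ _ → Subrelation.wellFounded proj₁ <-wellFounded)
      (constᵈ 0 0F) (0F <ᵈ 1F ∧ +ᵈ (suc (suc x)) 0F 1F) u)
    λ a → mk⇔ (reach⇒ (num C a x)) (λ (q , eq) → ⇒reach (num C a x) q (sym eq))
    where
    Jump : ℕ → ℕ → ℕ → Set
    Jump x u v = u < v × x + u ≡ v

    reach⇒ : ∀ x {u} → Reach (0 ≡_) (Jump x) u → ∃ λ q → u ≡ q * x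
    reach⇒ x (base refl) = 0 , refl
    reach⇒ x (step r (_ , eq)) =
      let q , u≡ = reach⇒ x r in suc q , trans (sym eq) (cong (x +_) u≡)

    ⇒reach : ∀ x q {u} → q * x ≡ u → Reach (0 ≡_) (Jump x) u
    ⇒reach x       zero    eq   = base eq
    ⇒reach zero    (suc q) eq   = ⇒reach zero q eq
    ⇒reach (suc x) (suc q) refl = step (⇒reach (suc x) q refl) (s≤s (m≤n+m _ x) , refl)

  -- For positive x, a multiple z of x has exactly z / x multiples of x below it. For x = 0 the
  -- count would be zero whatever y is, hence the separate disjunct.
  *ᵈ : (x y z : Num C) → Def C λ a → num C a x * num C a y ≡ num C a z
  *ᵈ x y z = transport
    ((constᵈ 0 x ∧ constᵈ 0 z) ∨
     (∃¹ (0F <ᵈ suc x) ∧ multipleᵈ x z ∧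
       ∃² (∀¹ (0F ∈ᵈ 0F ⇔ᵈ (0F <ᵈ suc z ∧ multipleᵈ (suc x) 0F)) ∧ cardᵈ 0F y)))
    λ _ → mk⇔ sound complete
    where
    Product : ℕ → ℕ → ℕ → Set
    Product x y z = (0 ≡ x × 0 ≡ z) ⊎ ((∃ λ u → u < x) × (∃ λ q → z ≡ q * x) ×
      ∃ λ W → (∀ u → u ∈ W ⇔ (u < z × ∃ λ q → u ≡ q * x)) × ∣ W ∣ ≡ y)

    sound : ∀ {x y z} → Product x y z → x * y ≡ z
    sound (inj₁ (refl , refl)) = refl
    sound {suc x} {y} {z} (inj₂ (_ , (q , refl) , W , W≡ , eq)) =
      trans (cong (suc x *_) y≡q) (*-comm (suc x) q)
      where
      y≡q : y ≡ q
      y≡q = trans (sym eq) (trans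
        (∣∣-ext W (multiples (suc x) q) λ u → ⇔-sym (∈-multiples (suc x) q u) ⇔-∘ W≡ u)
        (length-applyUpTo (_* suc x) q))

    complete : ∀ {x y z} → x * y ≡ z → Product x y z
    complete {zero} eq = inj₁ (refl , eq)
    complete {suc x} {y} refl = inj₂ ((0 , s≤s z≤n) , (y , *-comm (suc x) y) ,
      multiples (suc x) y ,
      (λ u → subst (λ b → u ∈ multiples (suc x) y ⇔ (u < b × ∃ λ q → u ≡ q * suc x))
        (*-comm y (suc x)) (∈-multiples (suc x) y u)) ,
      length-applyUpTo (_* suc x) y)

  pairᵈ : (x y z : Num C) → Def C λ a → pair (num C a x) (num C a y) ≡ num C a z
  pairᵈ {C} x y z = transport
    -- The bound numbers are in turn s = x + y, `suc s`, their product and half of that product,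
    -- which is `triangle s`.
    (∃¹ (+ᵈ (suc x) (suc y) 0F ∧ ∃¹ (sucᵈ 1F 0F ∧ ∃¹ (*ᵈ 2F 1F 0F ∧
      ∃¹ (+ᵈ 0F 0F 1F ∧ +ᵈ 0F (suc (suc (suc (suc y)))) (suc (suc (suc (suc z)))))))))
    λ a → let s = num C a x + num C a y in mk⇔
      (λ { (_ , refl , _ , refl , _ , refl , t , eq , eq′) →
        trans (cong (_+ num C a y)
          (double-injective (triangle s) t (trans (double-triangle s) (sym eq)))) eq′ })
      (λ eq → s , refl , suc s , refl , s * suc s , refl , triangle s , double-triangle s , eq)

  pairConstᵈ : (c : ℕ) (x y : Num C) → Def C λ a → pair c (num C a x) ≡ num C a y
  pairConstᵈ c x y = transport (∃¹ (constᵈ c 0F ∧ pairᵈ 0F (suc x) (suc y)))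
    λ _ → mk⇔ (λ { (_ , refl , eq) → eq }) (λ eq → c , refl , eq)

  -- A computation is a path through the codes `pair i y` of its stages. Every step raises i, so
  -- steps are well-founded and `reachᵈ` applies.
  iterᵈ : ∀ {n} {B : Vec ℕ n → ℕ → Set} {G : Vec ℕ n → ℕ → ℕ → ℕ → Set} →
          (∀ {C} (v : Tuple C n) x → Def C λ a → B (values v a) (num C a x)) →
          (∀ {C} (v : Tuple C n) x y z → Def C λ a →
            G (values v a) (num C a x) (num C a y) (num C a z)) →
          ∀ {C} (v : Tuple C n) x y → Def C λ a →
            Iter (B (values v a)) (G (values v a)) (num C a x) (num C a y)
  iterᵈ {n} {B} {G} b g {C} v x y = transport
    (∃¹ (pairᵈ (suc x) (suc y) 0F ∧
      reachᵈ {B = λ (a , _) → Start (values v a)} {E = λ (a , _) → Next (values v a)}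
        (λ (a , _) → next-wf (values v a))
        (∃¹ (pairConstᵈ 0 0F 1F ∧ b (v ↑¹ ↑² ↑¹ ↑¹) 0F))
        (∃¹ (∃¹ (∃¹ (pairᵈ 2F 1F 3F ∧
          ∃¹ (sucᵈ 3F 0F ∧ pairᵈ 0F 1F 5F ∧
            g (v ↑¹ ↑² ↑¹ ↑¹ ↑¹ ↑¹ ↑¹ ↑¹) 3F 2F 1F)))))
        0F))
    λ a → mk⇔ (λ (u , eq , r) → reach⇒ (values v a) r _ _ eq)
              (λ it → _ , refl , ⇒reach (values v a) it)
    where
    Start : Vec ℕ n → ℕ → Set
    Start xs u = ∃ λ y → pair 0 y ≡ u × B xs y

    Next : Vec ℕ n → ℕ → ℕ → Set
    Next xs u w = ∃ λ i → ∃ λ y → ∃ λ z → pair i y ≡ u ×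
      ∃ λ j → suc i ≡ j × pair j z ≡ w × G xs i y z

    next-acc : ∀ xs i y → Acc (Next xs) (pair i y)
    next-acc xs i y = acc (below i)
      where
      below : ∀ i {u} → Next xs u (pair i y) → Acc (Next xs) u
      -- Injectivity of `pair` gives i = `suc i′`, so the recursion is on a smaller stage.
      below i (i′ , y′ , z , refl , _ , refl , eq , _) with pair-injective (suc i′) z i y eq
      ... | refl , _ = next-acc xs i′ y′

    next-wf : ∀ xs → WellFounded (Next xs)
    -- No decomposition of u as a pair is at hand, but every predecessor of u comes with one.
    next-wf xs u = acc λ { (i , y , _ , refl , _) → next-acc xs i y }

    reach⇒ : ∀ xs {u} → Reach (Start xs) (Next xs) u → ∀ i y → pair i y ≡ u →
             Iter (B xs) (G xs) i y
    reach⇒ xs (base (y′ , eq′ , By)) i y eq with pair-injective i y 0 y′ (trans eq (sym eq′))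
    ... | refl , refl = base By
    reach⇒ xs (step r (i′ , y′ , z , eq″ , _ , refl , eq′ , Gyz)) i y eq
      with pair-injective i y (suc i′) z (trans eq (sym eq′))
    ... | refl , refl = step (reach⇒ xs r i′ y′ eq″) Gyz

    ⇒reach : ∀ xs {i y} → Iter (B xs) (G xs) i y → Reach (Start xs) (Next xs) (pair i y)
    ⇒reach xs (base By) = base (_ , refl , By)
    ⇒reach xs (step it Gyz) =
      step (⇒reach xs it) (_ , _ , _ , refl , _ , refl , refl , Gyz)

  ⇓ᵈ : ∀ {n} (f : Rec n) {C} (v : Tuple C n) (y : Num C) →
       Def C λ a → f [ values v a ]⇓ num C a y
  -- Recursion through the vector shows that each `lookup gs i` is structurally smaller than
  -- `comp f gs`.
  ⇓ᵈ* : ∀ {n k} (gs : Vec (Rec n) k) (i : Fin k) {C} (v : Tuple C n) (y : Num C) →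
        Def C λ a → lookup gs i [ values v a ]⇓ num C a y

  ⇓ᵈ* (g ∷ _)  zero    = ⇓ᵈ g
  ⇓ᵈ* (_ ∷ gs) (suc i) = ⇓ᵈ* gs i

  ⇓ᵈ zero v y = transport (constᵈ 0 y) λ _ → zero⇔
  -- Splitting the variables does not split the values, so the equivalence is moved along `agree`.
  ⇓ᵈ succ v y with record { vars = x ∷ [] ; agree = agree } ← v =
    transport (sucᵈ x y) λ a → subst (λ xs → _ ⇔ succ [ xs ]⇓ _) (agree a) succ⇔
  ⇓ᵈ (proj i) {C} v y = transport (lookup (vars v) i ≡ᵈ y) λ a →
    proj⇔ i ⇔-∘ subst⇔ (_≡ num C a y)
      (trans (sym (lookup-map i (num C a) (vars v))) (cong (λ xs → lookup xs i) (agree v a)))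
  ⇓ᵈ (comp {k = k} f gs) {C} v y = transport (∃¹* (⋀ component ∧ outer)) λ _ → comp⇔
    where
    component : (i : Fin k) → Def (C ▸¹* k) λ (a , ys) → lookup gs i [ values v a ]⇓ lookup ys i
    component i = transport (⇓ᵈ* gs i (v ↑¹* k) (i ↑ˡ #num C)) λ (a , ys) →
      subst⇔ (lookup gs i [ values v a ]⇓_) (lookup-++ˡ ys (numbers C a) i)

    outer : Def (C ▸¹* k) λ (a , ys) → f [ ys ]⇓ num C a y
    outer = transport (⇓ᵈ f (newest k) (k ↑ʳ y)) λ (a , ys) →
      subst⇔ (f [ ys ]⇓_) (lookup-++ʳ ys (numbers C a) y)
  ⇓ᵈ (prec f g) v y with record { vars = x ∷ xs ; agree = agree } ← v =
    transport
      (iterᵈ {B = λ xs → f [ xs ]⇓_} {G = λ xs i v w → g [ i ∷ v ∷ xs ]⇓ w}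
        (⇓ᵈ f) (λ v i u w → ⇓ᵈ g (i ∷ᵗ u ∷ᵗ v) w) (tuple xs) x y)
      λ a → subst (λ xs → _ ⇔ prec f g [ xs ]⇓ _) (agree a) prec⇔
  ⇓ᵈ (min f) v y = transport
    (∃¹ (constᵈ 0 0F ∧ ⇓ᵈ f (suc y ∷ᵗ v ↑¹) 0F) ∧
     ∀¹ (0F <ᵈ suc y ⇒ ∃¹ (∃¹ (sucᵈ 1F 0F ∧ ⇓ᵈ f (2F ∷ᵗ v ↑¹ ↑¹ ↑¹) 0F))))
    λ _ → min⇔

  -- The code is primitive recursive in n. Each step names `value s` and the intermediate pairs by
  -- variables.
  numeralCodeᵈ : ∀ z s (n e : Num C) →
                 Def C λ a → value (numeralCode z s (num C a n)) ≡ num C a e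
  numeralCodeᵈ {C} z s n e = transport
    (iterᵈ {B = λ _ → value z ≡_} {G = λ _ _ → NextCode} (λ _ → constᵈ (value z))
      (λ _ _ v w → ∃¹ (constᵈ (value s) 0F ∧ ∃¹ (pairᵈ (suc (suc v)) 1F 0F ∧
        ∃¹ (pairConstᵈ 4 1F 0F ∧ pairConstᵈ 7 0F (suc (suc (suc w)))))))
      (tuple []) n e)
    λ a → mk⇔ iter⇒ (λ eq → subst (Iter _ _ (num C a n)) eq (⇒iter (num C a n)))
    where
    NextCode : ℕ → ℕ → Set
    NextCode v w = ∃ λ s′ → value s ≡ s′ × ∃ λ p → pair v s′ ≡ p ×
      ∃ λ q → pair 4 p ≡ q × pair 7 q ≡ w

    iter⇒ : ∀ {n e} → Iter (value z ≡_) (λ _ → NextCode) n e → value (numeralCode z s n) ≡ e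
    iter⇒ (base z≡) = z≡
    iter⇒ (step {i} {v} it (_ , refl , _ , refl , _ , refl , refl)) =
      cong (λ c → pair 7 (pair 4 (pair c (value s))))
        {value (numeralCode z s i)} {v} (iter⇒ it)

    ⇒iter : ∀ n → Iter (value z ≡_) (λ _ → NextCode) n (value (numeralCode z s n))
    ⇒iter zero    = base refl
    ⇒iter (suc n) = step (⇒iter n) (_ , refl , _ , refl , _ , refl , refl)

  -- Codes of numerals and the diagonal sentence

  zero-code : ∃ λ z → ∀ C → HasCode (formula (constᵈ {C ▸¹} 0 0F)) z
  zero-code = _ , λ _ → forall¹-code (not-code (less-code 0F 1F refl refl))

  suc-code : ∃ λ s → ∀ C → HasCode (formula (sucᵈ {C ▸¹ ▸¹} 0F 1F)) s
  suc-code = _ , λ _ → and-code (less-code 0F 1F refl refl)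
    (not-code (exists¹-code (and-code (less-code 1F 0F refl refl) (less-code 0F 2F refl refl))))

  -- Codes record indices but not the context, so one code serves every C. The codes z and s are
  -- arbitrary here, so they are not unfolded.
  numeral-code : ∀ {z s} → (∀ C → HasCode (formula (constᵈ {C ▸¹} 0 0F)) z) →
                 (∀ C → HasCode (formula (sucᵈ {C ▸¹ ▸¹} 0F 1F)) s) →
                 ∀ n C → HasCode (formula (constᵈ {C ▸¹} n 0F)) (numeralCode z s n)
  numeral-code z-code s-code zero    C = z-code C
  numeral-code z-code s-code (suc n) C =
    exists¹-code (and-code (numeral-code z-code s-code n (C ▸¹)) (s-code C))

  closed : Context
  closed = record { Env = ⊤ ; numbers = λ _ → [] ; sets = λ _ → [] }

  module _ (f : Rec 1) where

    -- For x the code of a formula φ in one variable, d is the code of a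
    -- sentence asserting φ of x.
    RejectsDiagonal : Code → Code → ℕ → Set
    RejectsDiagonal z s x =
      ∃ λ e → value (numeralCode z s x) ≡ e × ∃ λ p → pair e x ≡ p ×
      ∃ λ q → pair 4 p ≡ q × ∃ λ d → pair 7 q ≡ d × ∃ λ r → 0 ≡ r × f [ d ∷ [] ]⇓ r

    rejectsDiagonalᵈ : ∀ z s (x : Num C) → Def C λ a → RejectsDiagonal z s (num C a x)
    rejectsDiagonalᵈ z s x =
      ∃¹ (numeralCodeᵈ z s (suc x) 0F ∧ ∃¹ (pairᵈ 1F (suc (suc x)) 0F ∧
      ∃¹ (pairConstᵈ 4 1F 0F ∧ ∃¹ (pairConstᵈ 7 1F 0F ∧ ∃¹ (constᵈ 0 0F ∧
      ⇓ᵈ f (tuple (1F ∷ [])) 0F)))))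

    -- The formula of `φᵈ` says of x that f rejects the sentence asserting the formula coded by x of
    -- x itself. Asserting it of its own code a gives a sentence about itself.
    diagonal : ∀ {z s} → (∀ n C → HasCode (formula (constᵈ {C ▸¹} n 0F)) (numeralCode z s n)) →
               Def (closed ▸¹) (λ (_ , x) → RejectsDiagonal z s x) →
               ∃ λ (ψ : Sentence σ) → WMSO M ψ ⇔ f [ ⌜ ψ ⌝ ∷ [] ]⇓ 0
    diagonal {z} {s} codes φᵈ = formula ψᵈ , mk⇔
      (λ ⊨ψ → to⇓ (to (correct ψᵈ tt) ⊨ψ)) (λ f⇓ → from (correct ψᵈ tt) (⇓to f⇓))
      where
      a : ℕ
      a = ⌜ formula φᵈ ⌝

      ψᵈ : Def closed λ _ → ∃ λ x → a ≡ x × RejectsDiagonal z s x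
      ψᵈ = ∃¹ (constᵈ a 0F ∧ φᵈ)

      -- This is the code d that `RejectsDiagonal` assembles from x = a.
      code : HasCode (formula ψᵈ) (leaf 7 ∙ leaf 4 ∙ numeralCode z s a ∙ leaf a)
      code = exists¹-code (and-code (codes a closed) (hasCode refl))

      to⇓ : (∃ λ x → a ≡ x × RejectsDiagonal z s x) → f [ ⌜ formula ψᵈ ⌝ ∷ [] ]⇓ 0
      to⇓ (_ , refl , _ , refl , _ , refl , _ , refl , _ , refl , _ , refl , f⇓) =
        subst (λ d → f [ d ∷ [] ]⇓ 0) (sym (HasCode.proof code)) f⇓

      ⇓to : f [ ⌜ formula ψᵈ ⌝ ∷ [] ]⇓ 0 → ∃ λ x → a ≡ x × RejectsDiagonal z s x
      ⇓to f⇓ = a , refl , _ , refl , _ , refl , _ , refl , _ , refl , _ , refl ,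
        subst (λ d → f [ d ∷ [] ]⇓ 0) (HasCode.proof code) f⇓

  undecidable : UndecidableTheory (WMSO M)
  undecidable (f , decides) =
    let ψ , ψ⇔ = diagonal f (numeral-code (proj₂ zero-code) (proj₂ suc-code))
                   (rejectsDiagonalᵈ f _ _ 0F)
        accepts , rejects = decides ψ
        -- If ψ were true, f would return both 1 and 0 on its code.
        ¬ψ = λ ⊨ψ → 1+n≢0 (⇓-functional (accepts ⊨ψ) (to ψ⇔ ⊨ψ))
    in ¬ψ (from ψ⇔ (rejects ¬ψ))

free : ℕ → ℕ → Context
free m k = record { Env = Vec ℕ m × Vec FiniteSet k ; numbers = proj₁ ; sets = proj₂ }

definable : ∀ {σ m k} {M : Structure σ} {S : Vec ℕ m → Vec FiniteSet k → Set} →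
            Definability.Def M (free m k) (λ (xs , Xs) → S xs Xs) → Definable M S
definable {M = M} d = formula d , λ xs Xs → correct d (xs , Xs)
  where open Definability M

symbolᵈ : ∀ {n} (R : SetRelation n) → DefinableRelation ⟨ℕ,<, R ⟩ R
symbolᵈ R Xs = Definability._,_ (rel (here refl) Xs) λ _ → ⇔-id _

theorem3p6 : ExcludedMiddle 0ℓ →
    (n : ℕ) → n ≥ 1 →
    (R : SetRelation n) →
    IsCardinalityRelation R →
    ¬ DefinableSetRelation ⟨ℕ,<⟩ R →
    DefinableFunction ⟨ℕ,<, R ⟩ _+_ ×
    DefinableFunction ⟨ℕ,<, R ⟩ _*_ ×
    UndecidableTheory (WMSO ⟨ℕ,<, R ⟩)
theorem3p6 em n _ R R-card ¬Rᵈ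
  with dichotomy em {M = ⟨ℕ,<, R ⟩} {N = ⟨ℕ,<⟩} n R-card (symbolᵈ R)
-- Definability over all contexts is specialized to the n free set variables, taken in order.
... | inj₂ Rᵈ = ⊥-elim (¬Rᵈ (definable (Definability.transport ⟨ℕ,<⟩ (Rᵈ (allFin n))
        λ (_ , Xs) → subst⇔ R (map-lookup-allFin Xs))))
... | inj₁ ∣∣≡ᵈ = graph (+ᵈ 0F 1F 2F) , graph (*ᵈ 0F 1F 2F) , undecidable
  where
  open Arithmetic {M = ⟨ℕ,<, R ⟩} ∣∣≡ᵈ

  graph : ∀ {f : ℕ → ℕ → ℕ} →
          Definability.Def ⟨ℕ,<, R ⟩ (free 3 0)
            (λ (xs , _) → f (lookup xs 0F) (lookup xs 1F) ≡ lookup xs 2F) →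
          DefinableFunction ⟨ℕ,<, R ⟩ f
  graph d = definable (Definability.transport ⟨ℕ,<, R ⟩ d
    λ { (_ ∷ _ ∷ _ ∷ [] , _) → ⇔-id _ })
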